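{- For $n>1$, there are continuum many ($2^{\aleph_0}$) $\sqcup$-irreducible elements in $\widehat{\mathcal F_n}$.
   Context: Fix $n\ge1$ and symbols $P_1,\dots,P_n$. The partially ordered set $(K_n,\le)$ with valuation map $\mathrm{val}:K_n\to\mathfrak P(\{P_1,\dots,P_n\})$ is the increasing union of finite sets $K_n^d$ ($d\ge 0$) built recursively: $K_n^{ -1}=\emptyset$, and $K_n^d\setminus K_n^{d-1}$ consists of exactly one point $w_{\beta,Y}$ for each pair $(\beta,Y)$ such that (i) $Y$ is a decreasing subset of $K_n^{d-1}$ with $Y\not\subseteq K_n^{d-2}$ (for $d=0$ this last condition is void, so $Y=\emptyset$); (ii) $\beta\subseteq\{P_1,\dots,P_n\}$ and $\beta\subseteq\mathrm{val}(w')$ for all $w'\in Y$; (iii) if $Y$ is the decreasing set generated by a single element $w_{\beta',Y'}$, then $\beta\ne\beta'$. One sets $\mathrm{val}(w_{\beta,Y})=\beta$, and $w\le w_{\beta,Y}$ iff $w\in Y$ or $w=w_{\beta,Y}$. $\widehat{\mathcal F_n}:=\mathcal O_\downarrow(K_n,\le)$ is the Heyting algebra of all decreasing subsets of $K_n$ ($\sqcap=\cap$, $\sqcup=\cup$). An element $a$ of a lattice is $\sqcup$-irreducible if $a\ne0$ and $a$ cannot be written as $b_1\sqcup b_2$ with $b_1\neq a$ and $b_2\ne a$. -}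

module Defs where

open import Level using (Level; 0ℓ; suc; _⊔_)
open import Data.Bool.Base using (Bool; true; T)
open import Data.Empty using (⊥; ⊥-elim)
open import Data.Fin.Subset using (Subset) renaming (_⊆_ to _⊆ˢ_)
open import Data.Nat.Base as ℕ using (ℕ; zero; _<_)
open import Data.Nat.Properties using (n<1+n; m<n⇒m<1+n; <-asym; <-irrefl)
open import Data.Product using (Σ; ∃; ∃₂; _×_; _,_; proj₁; proj₂)
open import Data.Sum using (_⊎_; inj₁; inj₂)
open import Data.Unit using (⊤; tt)
open import Function.Bundles using (_⇔_)
open import Relation.Binary.Bundles using (Setoid; Poset)
open import Relation.Binary.Core using (Rel)
open import Relation.Binary.Lattice.Bundles using (BoundedLattice; HeytingAlgebra)
open import Relation.Binary.PropositionalEquality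
  using (_≡_; _≢_; refl; sym; trans; subst)
open import Relation.Nullary.Negation using (¬_)
open import Relation.Unary using (Pred; _∈_; _⊆_; _≐_; _∪_; _∩_; ∅; U)

private
  variable
    c ℓ₁ ℓ₂ : Level

------------------------------------------------------------------------
-- Lattice theory

module _ (L : BoundedLattice c ℓ₁ ℓ₂) where
  private module L = BoundedLattice L

  ⊔-Irreducible : Pred L.Carrier (c ⊔ ℓ₁)
  ⊔-Irreducible a =
    ¬ (a L.≈ L.⊥) ×
    ¬ (∃₂ λ b₁ b₂ → a L.≈ (b₁ L.∨ b₂) × ¬ (b₁ L.≈ a) × ¬ (b₂ L.≈ a))

  -- Equality ignores the proof of irreducibility.
  ⊔-irreducibles : Setoid (c ⊔ ℓ₁) ℓ₁
  ⊔-irreducibles = record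
    { Carrier       = Σ L.Carrier ⊔-Irreducible
    ; _≈_           = λ a b → proj₁ a L.≈ proj₁ b
    ; isEquivalence = record
      { refl  = L.Eq.refl
      ; sym   = L.Eq.sym
      ; trans = L.Eq.trans
      }
    }

module _ (P : Poset 0ℓ 0ℓ 0ℓ) where
  private module P = Poset P

  record DecreasingSubset : Set (suc 0ℓ) where
    constructor _↓_
    field
      set        : Pred P.Carrier 0ℓ
      decreasing : ∀ {x y} → x P.≤ y → y ∈ set → x ∈ set

  open DecreasingSubset

  𝓞↓ : HeytingAlgebra (suc 0ℓ) 0ℓ 0ℓ
  𝓞↓ = record
    { Carrier = DecreasingSubset
    ; _≈_     = λ A B → set A ≐ set B
    ; _≤_     = λ A B → set A ⊆ set B
    ; _∨_     = λ A B → (set A ∪ set B) ↓ λ where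
        x≤y (inj₁ y∈A) → inj₁ (decreasing A x≤y y∈A)
        x≤y (inj₂ y∈B) → inj₂ (decreasing B x≤y y∈B)
    ; _∧_     = λ A B → (set A ∩ set B) ↓ λ where
        x≤y (y∈A , y∈B) → decreasing A x≤y y∈A , decreasing B x≤y y∈B
    ; _⇨_     = λ A B →
        (λ x → ∀ {y} → y P.≤ x → y ∈ set A → y ∈ set B) ↓
        λ x≤y h z≤x → h (P.trans z≤x x≤y)
    ; ⊤       = U ↓ λ _ _ → tt
    ; ⊥       = ∅ ↓ λ _ ()
    ; isHeytingAlgebra = record
      { isBoundedLattice = record
        { isLattice = record
          { isPartialOrder = record
            { isPreorder = record
              { isEquivalence = record
                { refl  = (λ z → z) , (λ z → z)
                ; sym   = λ (p , q) → q , p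
                ; trans = λ (p , q) (r , s) → (λ z → r (p z)) , (λ z → q (s z))
                }
              ; reflexive = proj₁
              ; trans     = λ p q z → q (p z)
              }
            ; antisym = _,_
            }
          ; supremum = λ _ _ → inj₁ , inj₂ , λ _ p q → λ where
              (inj₁ z) → p z
              (inj₂ z) → q z
          ; infimum = λ _ _ → proj₁ , proj₂ , λ _ p q z → p z , q z
          }
        ; maximum = λ _ _ → tt
        ; minimum = λ _ ()
        }
      ; exponential = λ A B C →
          (λ h x∈A y≤x y∈B → h (decreasing A y≤x x∈A , y∈B)) ,
          (λ h (x∈A , x∈B) → h x∈A P.refl x∈B)
      }
    }

------------------------------------------------------------------------
-- The poset Kₙ

-- The pairs (β , Y) that index the new points over a stage A of the
-- construction.  The symbols P₁ … Pₙ are the elements of Fin n.  A is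
-- finite up to the equality _≋_ below, so its subsets are given by
-- characteristic functions; they respect that equality because the
-- order contains it.  Fresh Y says that Y is not contained in the stage
-- before A; it is a parameter because it is void for the first stage.

record Pair (n : ℕ) {A : Set} (_≤_ : Rel A 0ℓ) (val : A → Subset n)
            (Fresh : Pred (A → Bool) 0ℓ) : Set where
  field
    β            : Subset n
    Y            : A → Bool
    decreasing   : ∀ {x y} → x ≤ y → T (Y y) → T (Y x)
    fresh        : Fresh Y
    β⊆val        : ∀ x → T (Y x) → β ⊆ˢ val x
    notPrincipal : ∀ x → (∀ y → T (Y y) ⇔ (y ≤ x)) → β ≢ val x

-- There is one point for each β and each subset Y: the proofs of the
-- side conditions are ignored, and Y is compared extensionally.

_≋_ : ∀ {n} {A : Set} {_≤_ : Rel A 0ℓ} {val : A → Subset n}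
      {Fresh : Pred (A → Bool) 0ℓ} → Rel (Pair n _≤_ val Fresh) 0ℓ
p ≋ q = Pair.β p ≡ Pair.β q × (∀ x → Pair.Y p x ≡ Pair.Y q x)

module Construction (n : ℕ) where

  -- Point d is Kₙᵈ ∖ Kₙᵈ⁻¹, whereas Stage d is Kₙᵈ⁻¹, the points of
  -- depth less than d.

  Stage : ℕ → Set
  Point : ℕ → Set

  Order : ∀ d → Rel (Stage d) 0ℓ
  val   : ∀ d → Stage d → Subset n
  Fresh : ∀ d → Pred (Stage d → Bool) 0ℓ

  Stage zero        = ⊥
  Stage (ℕ.suc d)   = Stage d ⊎ Point d

  Point d = Pair n (Order d) (val d) (Fresh d)

  Order (ℕ.suc d) (inj₁ x) (inj₁ y) = Order d x y
  Order (ℕ.suc d) (inj₁ x) (inj₂ q) = T (Pair.Y q x)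
  Order (ℕ.suc d) (inj₂ p) (inj₁ y) = ⊥
  Order (ℕ.suc d) (inj₂ p) (inj₂ q) = p ≋ q

  val (ℕ.suc d) (inj₁ x) = val d x
  val (ℕ.suc d) (inj₂ p) = Pair.β p

  Fresh zero      Y = ⊤
  Fresh (ℕ.suc d) Y = ∃ λ p → T (Y (inj₂ p))

  -- Kₙ is the union of the stages, split into the points of each depth.

  K : Set
  K = Σ ℕ Point

  valuation : K → Subset n
  valuation (d , p) = Pair.β p

  -- The inclusion of Kₙᵈ⁻¹ in Kₙ.

  ι : ∀ {d} → Stage d → K
  ι {ℕ.suc d} (inj₁ x) = ι x
  ι {ℕ.suc d} (inj₂ p) = d , p

  infix 4 _≈_ _≤_

  data _≈_ : Rel K 0ℓ where
    same : ∀ {d} {p q : Point d} → p ≋ q → (d , p) ≈ (d , q)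

  _≤_ : Rel K 0ℓ
  w ≤ (e , q) = (∃ λ x → T (Pair.Y q x) × ι x ≡ w) ⊎ w ≈ (e , q)

  ≋-refl : ∀ {d} {p : Point d} → p ≋ p
  ≋-refl = refl , λ _ → refl

  ≈-refl : ∀ {w} → w ≈ w
  ≈-refl {_ , p} = same (≋-refl {p = p})

  ≈-sym : ∀ {w v} → w ≈ v → v ≈ w
  ≈-sym (same (b , y)) = same (sym b , λ x → sym (y x))

  ≈-trans : ∀ {w v u} → w ≈ v → v ≈ u → w ≈ u
  ≈-trans (same (b , y)) (same (b′ , y′)) =
    same (trans b b′ , λ x → trans (y x) (y′ x))

  valuation-cong : ∀ {w v} → w ≈ v → valuation w ≡ valuation v
  valuation-cong (same (b , _)) = b

  -- Along ι, the order and valuation of every stage agree with those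
  -- of K, and the image of a stage is decreasing.

  ι-val : ∀ {d} (x : Stage d) → valuation (ι x) ≡ val d x
  ι-val {ℕ.suc d} (inj₁ x) = ι-val x
  ι-val {ℕ.suc d} (inj₂ p) = refl

  ι-mono : ∀ {d} (x y : Stage d) → Order d x y → ι x ≤ ι y
  ι-mono {ℕ.suc d} (inj₁ x) (inj₁ y) x≤y = ι-mono x y x≤y
  ι-mono {ℕ.suc d} (inj₁ x) (inj₂ q) x∈Y = inj₁ (x , x∈Y , refl)
  ι-mono {ℕ.suc d} (inj₂ p) (inj₂ q) p≋q = inj₂ (same p≋q)

  ι-lower : ∀ {d w} (y : Stage d) → w ≤ ι y → ∃ λ x → Order d x y × ι x ≡ w
  ι-lower {ℕ.suc d} (inj₁ y) w≤y with ι-lower y w≤y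
  ... | x , x≤y , eq = inj₁ x , x≤y , eq
  ι-lower {ℕ.suc d} (inj₂ q) (inj₁ (x , x∈Y , eq)) = inj₁ x , x∈Y , eq
  ι-lower {ℕ.suc d} (inj₂ q) (inj₂ (same {p = p} p≋q)) = inj₂ p , p≋q , refl

  ι-depth : ∀ {d} (x : Stage d) → proj₁ (ι x) < d
  ι-depth {ℕ.suc d} (inj₁ x) = m<n⇒m<1+n (ι-depth x)
  ι-depth {ℕ.suc d} (inj₂ p) = n<1+n d

  ≤-trans : ∀ {w v u} → w ≤ v → v ≤ u → w ≤ u
  ≤-trans {u = _ , q} w≤v (inj₁ (y , y∈Y , refl)) with ι-lower y w≤v
  ... | x , x≤y , eq = inj₁ (x , Pair.decreasing q x≤y y∈Y , eq)
  ≤-trans (inj₁ (x , x∈Y , eq)) (inj₂ (same (_ , y))) =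
    inj₁ (x , subst T (y x) x∈Y , eq)
  ≤-trans (inj₂ w≈v) (inj₂ v≈u) = inj₂ (≈-trans w≈v v≈u)

  ≤-antisym : ∀ {w v} → w ≤ v → v ≤ w → w ≈ v
  ≤-antisym (inj₂ w≈v) _          = w≈v
  ≤-antisym (inj₁ _)   (inj₂ v≈w) = ≈-sym v≈w
  ≤-antisym (inj₁ (x , _ , eq)) (inj₁ (y , _ , eq′)) = ⊥-elim
    (<-asym (subst (λ k → proj₁ k < _) eq (ι-depth x))
            (subst (λ k → proj₁ k < _) eq′ (ι-depth y)))

  poset : Poset 0ℓ 0ℓ 0ℓ
  poset = record
    { Carrier        = K
    ; _≈_            = _≈_
    ; _≤_            = _≤_
    ; isPartialOrder = record
      { isPreorder = record
        { isEquivalence = record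
          { refl = ≈-refl ; sym = ≈-sym ; trans = ≈-trans }
        ; reflexive = inj₂
        ; trans     = λ {w} {v} {u} → ≤-trans {w} {v} {u}
        }
      ; antisym = ≤-antisym
      }
    }

𝓕̂ : ℕ → HeytingAlgebra (suc 0ℓ) 0ℓ 0ℓ
𝓕̂ n = 𝓞↓ (Construction.poset n)

{-# OPTIONS --safe #-}

-- In K_n every finite family w₁, …, w_m has a cap: an upper bound z
-- such that everything strictly below z is below some wᵢ.  (If the
-- decreasing set generated by the wᵢ is principal, z is its generator;
-- otherwise z = w_{∅,Y} for that set Y.)
--
-- For n > 1 there are four minimal points e, p₀, p₁, p₂.  Replacing each
-- pᵢ by a cap of the other two gives again three incomparable points,
-- incomparable to e; iterating, and capping each triple together with e,
-- produces an infinite antichain x₀, x₁, ….  For S ⊆ ℕ the decreasing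
-- set { w | x_{k+1} ≤ w implies k ∈ S } determines S.  It is directed,
-- hence ⊔-irreducible: a cap of v, w and x₀ is no x_{k+1}, being above x₀,
-- and so is above x_{k+1} only if v or w is.  As K_n is countable, the
-- Cantor–Schröder–Bernstein theorem finishes the proof.

module Submission where

open import Defs
open import Level using (Level; 0ℓ; suc; _⊔_; Lift; lift; lower)
open import Axiom.ExcludedMiddle using (ExcludedMiddle)
open import Data.Bool.Base using (Bool; true; false; T)
open import Data.Empty using (⊥-elim)
open import Data.Fin.Base as Fin
  using (Fin; zero; toℕ; punchIn; punchOut; combine; finToFun; funToFin; join; splitAt)
open import Data.Fin.Patterns using (0F; 1F; 2F; 3F)
open import Data.Fin.Properties
  using (suc-injective; _≟_; toℕ<n; toℕ-↑ʳ; toℕ-injective; punchInᵢ≢i;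
         punchIn-injective; punchIn-punchOut; combine-injective; finToFun-funToFin;
         splitAt-join; 2↔Bool)
open import Data.Fin.Subset using (Subset; inside; outside) renaming (⊥ to ∅ˢ)
open import Data.Fin.Subset.Properties using (⊥⊆)
open import Data.Nat.Base as ℕ using (ℕ; _>_; _<_; _+_; _*_; _^_; z≤n; s≤s)
open import Data.Nat.Properties as ℕ
  using (<-cmp; m<1+n⇒m<n∨m≡n; m≤m+n)
open import Data.Product using (∃; _×_; _,_; proj₁; proj₂)
open import Data.Sum.Base as Sum using (_⊎_; inj₁; inj₂)
open import Data.Sum.Properties using (inj₁-injective; inj₂-injective)
open import Data.Unit.Base using (tt)
open import Data.Vec.Base using (lookup; tabulate) renaming (_∷_ to _∷ᵛ_)
open import Data.Vec.Functional using (_∷_; [])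
open import Data.Vec.Properties using (tabulate∘lookup; tabulate-cong)
open import Function.Base using (_∘_)
open import Function.Bundles
  using (Bijection; Injection; Inverse; Equivalence)
open import Relation.Binary.Bundles using (Setoid; Poset)
open import Relation.Binary.Definitions using (tri<; tri≈; tri>)
open import Relation.Binary.Lattice.Bundles using (HeytingAlgebra)
open import Relation.Binary.PropositionalEquality
  using (_≡_; _≗_; refl; sym; trans; cong; subst; _→-setoid_)
open import Relation.Nullary.Decidable.Core
  using (Dec; yes; no; map′; ⌊_⌋; toWitness; fromWitness; decidable-stable)
open import Relation.Nullary.Negation using (¬_; contradiction)
open import Relation.Unary using (Pred; _∈_)

private
  variable
    a b ℓ₁ ℓ₂ : Level

-- Excluded middle and truth values

lower-em : ∀ a b → ExcludedMiddle (a ⊔ b) → ExcludedMiddle a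
lower-em a b em = map′ lower lift (em {Lift b _})

T-injective : ∀ {x y} → (T x → T y) → (T y → T x) → x ≡ y
T-injective {false} {false} _ _ = refl
T-injective {false} {true}  _ g = ⊥-elim (g tt)
T-injective {true}  {false} f _ = ⊥-elim (f tt)
T-injective {true}  {true}  _ _ = refl

-- The Cantor-Schröder-Bernstein theorem for setoids

module _ {A : Setoid a ℓ₁} {B : Setoid b ℓ₂}
         (em : ExcludedMiddle (a ⊔ b ⊔ ℓ₁ ⊔ ℓ₂))
         (F : Injection A B) (G : Injection B A) where
  private
    module A = Setoid A
    module B = Setoid B
    module F = Injection F
    module G = Injection G

    em-image : ExcludedMiddle (b ⊔ ℓ₁)
    em-image = lower-em (b ⊔ ℓ₁) (a ⊔ ℓ₂) em

    -- The elements whose backward orbit under F and G stops in A.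
    data StopsInA : Pred A.Carrier (a ⊔ b ⊔ ℓ₁) where
      stop : ∀ {x} → ¬ (∃ λ y → G.to y A.≈ x) → StopsInA x
      back : ∀ {x x′} → G.to (F.to x′) A.≈ x → StopsInA x′ → StopsInA x

    stops? : ∀ x → Dec (StopsInA x)
    stops? x = lower-em (a ⊔ b ⊔ ℓ₁) ℓ₂ em

    resp : ∀ {x x′} → x A.≈ x′ → StopsInA x → StopsInA x′
    resp x≈x′ (stop ¬y)   = stop λ (y , eq) → ¬y (y , A.trans eq (A.sym x≈x′))
    resp x≈x′ (back eq s) = back (A.trans eq x≈x′) s

    preimage : ∀ {x} → ¬ StopsInA x → ∃ λ y → G.to y A.≈ x
    preimage ¬s = decidable-stable em-image (¬s ∘ stop)

    -- The bijection follows `F` where the backward orbit stops in `A`, and the inverse of `G`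
    -- elsewhere. As a relation it does not depend on which preimages get chosen.
    Graph : A.Carrier → B.Carrier → Set _
    Graph x y = (StopsInA x × F.to x B.≈ y) ⊎ (¬ StopsInA x × G.to y A.≈ x)

    graph : ∀ x → ∃ (Graph x)
    graph x with stops? x
    ... | yes s = F.to x , inj₁ (s , B.refl)
    ... | no ¬s = let y , eq = preimage ¬s in y , inj₂ (¬s , eq)

    functional : ∀ {x x′ y y′} → x A.≈ x′ → Graph x y → Graph x′ y′ → y B.≈ y′
    functional x≈ (inj₁ (_ , p)) (inj₁ (_ , q)) =
      B.trans (B.sym p) (B.trans (F.cong x≈) q)
    functional x≈ (inj₁ (s , _)) (inj₂ (¬s , _)) = contradiction (resp x≈ s) ¬s
    functional x≈ (inj₂ (¬s , _)) (inj₁ (s , _)) =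
      contradiction (resp (A.sym x≈) s) ¬s
    functional x≈ (inj₂ (_ , p)) (inj₂ (_ , q)) =
      G.injective (A.trans p (A.trans x≈ (A.sym q)))

    injective : ∀ {x x′ y y′} → y B.≈ y′ → Graph x y → Graph x′ y′ → x A.≈ x′
    injective y≈ (inj₁ (_ , p)) (inj₁ (_ , q)) =
      F.injective (B.trans p (B.trans y≈ (B.sym q)))
    -- Here `x′` is `G` of `F` of `x`, so its backward orbit passes through `x` and stops in `A`
    -- too.
    injective y≈ (inj₁ (s , p)) (inj₂ (¬s , q)) =
      contradiction (back (A.trans (G.cong (B.trans p y≈)) q) s) ¬s
    injective y≈ (inj₂ (¬s , p)) (inj₁ (s , q)) =
      contradiction (back (A.trans (G.cong (B.trans q (B.sym y≈))) p) s) ¬s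
    injective y≈ (inj₂ (_ , p)) (inj₂ (_ , q)) =
      A.trans (A.sym p) (A.trans (G.cong y≈) q)

    -- If the orbit of `G.to y` does not stop in `A`, that element is sent to `y`. If it does, it
    -- cannot stop at once, since `y` is a preimage, so one step back yields the required `x`.
    surjective : ∀ y → ∃ λ x → Graph x y
    surjective y with stops? (G.to y)
    ... | no ¬s                   = G.to y , inj₂ (¬s , A.refl)
    ... | yes (stop ¬y)           = contradiction (y , A.refl) ¬y
    ... | yes (back {x′ = x} p s) = x , inj₁ (s , G.injective p)

  cantor-schröder-bernstein : Bijection A B
  cantor-schröder-bernstein = record
    { to        = proj₁ ∘ graph
    ; cong      = λ {x} {x′} x≈x′ →
        functional x≈x′ (proj₂ (graph x)) (proj₂ (graph x′))
    ; bijective =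
        (λ {x} {x′} y≈ → injective y≈ (proj₂ (graph x)) (proj₂ (graph x′))) ,
        λ y → let x , xy = surjective y in
          x , λ {z} z≈x → functional z≈x (proj₂ (graph z)) xy
    }

-- Decreasing sets of a poset

module _ (em : ExcludedMiddle 0ℓ) (P : Poset 0ℓ 0ℓ 0ℓ) where
  private module P = Poset P
  open DecreasingSubset

  -- If `A` is the union of `B` and `C`, both proper, pick `x` outside `B` and `y` outside `C`. An
  -- upper bound of both in `A` lies in `B` or `C`, which then contains `x` or `y`.
  directed⇒⊔-irreducible : (A : DecreasingSubset P) → ∃ (_∈ set A) →
    (∀ {x y} → x ∈ set A → y ∈ set A → ∃ λ z → z ∈ set A × x P.≤ z × y P.≤ z) →
    ⊔-Irreducible (HeytingAlgebra.boundedLattice (𝓞↓ P)) A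
  directed⇒⊔-irreducible A (x , x∈A) directed =
    (λ A≐∅ → proj₁ A≐∅ x∈A) ,
    λ (B , C , (A⊆B∪C , B∪C⊆A) , B≉A , C≉A) →
      B≉A (B∪C⊆A ∘ inj₁ , λ {x} x∈A → decidable-stable em λ x∉B →
      C≉A (B∪C⊆A ∘ inj₂ , λ {y} y∈A → decidable-stable em λ y∉C →
        let z , z∈A , x≤z , y≤z = directed x∈A y∈A in
        Sum.[ x∉B ∘ decreasing B x≤z , y∉C ∘ decreasing C y≤z ] (A⊆B∪C z∈A)))

  module _ (code : P.Carrier → ℕ)
           (code-injective : ∀ {x y} → code x ≡ code y → x P.≈ y) where
    private
      HasCode : DecreasingSubset P → ℕ → Set
      HasCode A m = ∃ λ x → x ∈ set A × code x ≡ m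

      χ : DecreasingSubset P → ℕ → Bool
      χ A m = ⌊ em {HasCode A m} ⌋

      χ-mono : ∀ A B m → (∀ {x} → x ∈ set A → x ∈ set B) → T (χ A m) → T (χ B m)
      χ-mono A B m A⊆B t = let x , x∈A , eq = toWitness t in
        fromWitness (x , A⊆B x∈A , eq)

      -- Some point of `B` has the code of `x`, hence equals `x` up to `≈`, and decreasing sets are
      -- closed under `≈`.
      χ-reflects : ∀ A B → χ A ≗ χ B → ∀ {x} → x ∈ set A → x ∈ set B
      χ-reflects A B χA≗χB {x} x∈A =
        let y , y∈B , eq = toWitness
              (subst T (χA≗χB (code x)) (fromWitness {a? = em} (x , x∈A , refl)))
        in decreasing B (P.reflexive (code-injective (sym eq))) y∈B

    irreducibles↣ℕ→Bool :
      Injection (⊔-irreducibles (HeytingAlgebra.boundedLattice (𝓞↓ P)))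
                (ℕ →-setoid Bool)
    irreducibles↣ℕ→Bool = record
      { to        = λ (A , _) → χ A
      ; cong      = λ {(A , _)} {(B , _)} (A⊆B , B⊆A) m →
          T-injective (χ-mono A B m A⊆B) (χ-mono B A m B⊆A)
      ; injective = λ {(A , _)} {(B , _)} χA≗χB →
          χ-reflects A B χA≗χB , χ-reflects B A (sym ∘ χA≗χB)
      }

-- Bounds and encodings for finite families

bounded : ∀ {m} (h : Fin m → ℕ) → ∃ λ D → ∀ i → h i < D
bounded {ℕ.zero}  h = 0 , λ ()
bounded {ℕ.suc m} h = let D , h<D = bounded (h ∘ Fin.suc) in
  ℕ.suc (h zero) ℕ.⊔ D , λ where
    zero        → ℕ.m≤m⊔n (ℕ.suc (h zero)) D
    (Fin.suc i) → ℕ.≤-trans (h<D i) (ℕ.m≤n⊔m (ℕ.suc (h zero)) D)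

bits : ∀ {m} → (Fin m → Bool) → Fin (2 ^ m)
bits f = funToFin (Inverse.from 2↔Bool ∘ f)

bits-injective : ∀ {m} {f g : Fin m → Bool} → bits f ≡ bits g → f ≗ g
bits-injective {f = f} {g} eq i =
  trans (sym (decode f)) (trans (cong (λ c → to (finToFun c i)) eq) (decode g))
  where
  open Inverse 2↔Bool
  decode : ∀ h → to (finToFun (bits h) i) ≡ h i
  decode h = trans (cong to (finToFun-funToFin (from ∘ h) i)) (strictlyInverseˡ (h i))

join-injective : ∀ m n {s t : Fin m ⊎ Fin n} → join m n s ≡ join m n t → s ≡ t
join-injective m n {s} {t} eq =
  trans (sym (splitAt-join m n s)) (trans (cong (splitAt m) eq) (splitAt-join m n t))

module _ (em : ExcludedMiddle 0ℓ) (n : ℕ) where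
  open Construction n

  -- Counting K_n

  -- An upper bound for the number of points of depth less than `d`: at most `2 ^ n` choices of `β`
  -- and `2 ^ size d` of `Y`.
  size : ℕ → ℕ
  size ℕ.zero    = 0
  size (ℕ.suc d) = size d + 2 ^ n * 2 ^ size d

  module _ {d k} (code : Stage d → Fin k) where

    -- `Stage d` is finite only up to its equality, so `Y` is recorded by the codes of its members.
    Marked : Point d → Fin k → Set
    Marked p i = ∃ λ x → T (Pair.Y p x) × code x ≡ i

    pointCode : Point d → Fin (2 ^ n * 2 ^ k)
    pointCode p =
      combine (bits (lookup (Pair.β p))) (bits λ i → ⌊ em {Marked p i} ⌋)

    module _ (reflects : ∀ {x y} → code x ≡ code y → Order d x y) where

      Y-reflects : ∀ (p q : Point d) →
        (∀ i → ⌊ em {Marked p i} ⌋ ≡ ⌊ em {Marked q i} ⌋) →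
        ∀ x → T (Pair.Y p x) → T (Pair.Y q x)
      Y-reflects p q eq x x∈p =
        let y , y∈q , cy≡cx = toWitness
              (subst T (eq (code x)) (fromWitness {a? = em} (x , x∈p , refl)))
        in Pair.decreasing q (reflects (sym cy≡cx)) y∈q

      pointCode-injective : ∀ {p q} → pointCode p ≡ pointCode q → p ≋ q
      pointCode-injective {p} {q} eq =
        let eqβ , eqY = combine-injective _ _ _ _ eq
            Y≗ = bits-injective eqY
        in
        trans (sym (tabulate∘lookup (Pair.β p)))
              (trans (tabulate-cong (bits-injective eqβ)) (tabulate∘lookup (Pair.β q))) ,
        λ x → T-injective (Y-reflects p q Y≗ x) (Y-reflects q p (sym ∘ Y≗) x)

  stageCode : ∀ d → Stage d → Fin (size d)
  stageCode (ℕ.suc d) = join _ _ ∘ Sum.map (stageCode d) (pointCode (stageCode d))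

  stageCode-reflects : ∀ d {x y} → stageCode d x ≡ stageCode d y → Order d x y
  stageCode-reflects (ℕ.suc d) {x} {y} eq = reflects x y (join-injective _ _ eq)
    where
    c : Stage (ℕ.suc d) → Fin (size d) ⊎ Fin (2 ^ n * 2 ^ size d)
    c = Sum.map (stageCode d) (pointCode (stageCode d))
    reflects : ∀ x y → c x ≡ c y → Order (ℕ.suc d) x y
    reflects (inj₁ x) (inj₁ y) eq = stageCode-reflects d (inj₁-injective eq)
    reflects (inj₂ p) (inj₂ q) eq =
      pointCode-injective (stageCode d) (stageCode-reflects d) {p} {q} (inj₂-injective eq)

  size-mono : ∀ {d e} → d ℕ.≤ e → size d ℕ.≤ size e
  size-mono {e = ℕ.zero}  z≤n = ℕ.≤-refl
  size-mono {d} {ℕ.suc e} d≤e with ℕ.m≤n⇒m<n∨m≡n d≤e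
  ... | inj₁ (s≤s d≤e′) = ℕ.≤-trans (size-mono d≤e′) (m≤m+n (size e) _)
  ... | inj₂ refl       = ℕ.≤-refl

  -- Points of depth `d` get codes from `size d` up to, but excluding, `size (suc d)`, so codes at
  -- different depths never clash.
  code : K → ℕ
  code (d , p) = toℕ (stageCode (ℕ.suc d) (inj₂ p))

  size≤code : ∀ d (p : Point d) → size d ℕ.≤ code (d , p)
  size≤code d p = ℕ.≤-trans (m≤m+n (size d) _) (ℕ.≤-reflexive (sym (toℕ-↑ʳ (size d) _)))

  code-< : ∀ {d e} (p : Point d) (q : Point e) → d < e → code (d , p) < code (e , q)
  code-< {e = e} p q d<e =
    ℕ.<-≤-trans (toℕ<n _) (ℕ.≤-trans (size-mono d<e) (size≤code e q))

  code-injective : ∀ {w v} → code w ≡ code v → w ≈ v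
  code-injective {d , p} {e , q} eq with <-cmp d e
  ... | tri< d<e _ _  = contradiction eq (ℕ.<⇒≢ (code-< p q d<e))
  ... | tri≈ _ refl _ = same (stageCode-reflects (ℕ.suc d) {inj₂ p} {inj₂ q}
                               (toℕ-injective eq))
  ... | tri> _ _ e<d  = contradiction (sym eq) (ℕ.<⇒≢ (code-< q p e<d))

  -- Caps

  ≤-refl : ∀ {w} → w ≤ w
  ≤-refl = inj₂ ≈-refl

  depth-mono : ∀ {w v} → w ≤ v → proj₁ w ℕ.≤ proj₁ v
  depth-mono (inj₁ (x , _ , refl)) = ℕ.<⇒≤ (ι-depth x)
  depth-mono (inj₂ (same _))       = ℕ.≤-refl

  ι-surjective : ∀ {d} w → proj₁ w < d → ∃ λ (x : Stage d) → ι x ≡ w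
  ι-surjective {ℕ.suc d} w w<d with m<1+n⇒m<n∨m≡n w<d
  ... | inj₁ w<d′ = let x , eq = ι-surjective w w<d′ in inj₁ x , eq
  ... | inj₂ refl = inj₂ (proj₂ w) , refl

  module _ (P : Pred K 0ℓ) (decreasing : ∀ {w v} → w ≤ v → v ∈ P → w ∈ P) where

    IsCap : Pred K 0ℓ
    IsCap z = (∀ {w} → w ∈ P → w ≤ z) × (∀ {w} → w ≤ z → w ∈ P ⊎ w ≈ z)

    Principal : Set
    Principal = ∃ λ z → ∀ w → (w ∈ P → w ≤ z) × (w ≤ z → w ∈ P)

    indicator : ∀ d → Stage d → Bool
    indicator d x = ⌊ em {ι x ∈ P} ⌋

    capOfDepth : ∀ d → Fresh d (indicator d) → (∀ {w} → w ∈ P → proj₁ w < d) →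
                 ¬ Principal → ∃ IsCap
    capOfDepth d fresh P<d ¬principal = (d , p) , upper , lower′
      where
      p : Point d
      p = record
        { β            = ∅ˢ
        ; Y            = indicator d
        ; decreasing   = λ {x} {y} x≤y y∈P →
            fromWitness (decreasing (ι-mono x y x≤y) (toWitness y∈P))
        ; fresh        = fresh
        ; β⊆val        = λ _ _ → ⊥⊆
        -- A generator `x` of `Y` within the stage would make `ι x` a generator of `P` in all of
        -- `K`.
        ; notPrincipal = λ x generates _ → ¬principal (ι x , λ w →
            (λ w∈P → let y , eq = ι-surjective w (P<d w∈P) in
              subst (_≤ ι x) eq (ι-mono y x (Equivalence.to (generates y)
                (fromWitness (subst P (sym eq) w∈P))))) ,
            λ w≤ιx → let y , y≤x , eq = ι-lower x w≤ιx in
              subst P eq (toWitness (Equivalence.from (generates y) y≤x)))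
        }

      upper : ∀ {w} → w ∈ P → w ≤ (d , p)
      upper {w} w∈P with ι-surjective w (P<d w∈P)
      ... | x , refl = inj₁ (x , fromWitness w∈P , refl)

      lower′ : ∀ {w} → w ≤ (d , p) → w ∈ P ⊎ w ≈ (d , p)
      lower′ (inj₁ (x , x∈P , refl)) = inj₁ (toWitness x∈P)
      lower′ (inj₂ w≈z)              = inj₂ w≈z

    -- Freshness at depth `suc d` asks for a member of `P` of depth exactly `d`. If there is none,
    -- `d` is already a bound, and the search descends.
    cap-bounded : ∀ d → (∀ {w} → w ∈ P → proj₁ w < d) → ∃ IsCap
    cap-bounded d P<d with em {Principal}
    ... | yes (z , generates) =
      z , (λ {w} → proj₁ (generates w)) , (λ {w} → inj₁ ∘ proj₂ (generates w))
    -- Here `P` is empty and the cap is a minimal point.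
    cap-bounded ℕ.zero    P<d | no ¬principal = capOfDepth 0 tt P<d ¬principal
    cap-bounded (ℕ.suc d) P<d | no ¬principal with em {∃ λ p → (d , p) ∈ P}
    ... | yes (p , p∈P) =
      capOfDepth (ℕ.suc d) (p , fromWitness p∈P) P<d ¬principal
    ... | no ¬p = cap-bounded d λ {w} w∈P →
      Sum.[ (λ w<d → w<d) , (λ where refl → contradiction (proj₂ w , w∈P) ¬p) ]
        (m<1+n⇒m<n∨m≡n (P<d w∈P))

  cap : ∀ {m} (ws : Fin m → K) → ∃ λ z →
        (∀ i → ws i ≤ z) × (∀ {v} → v ≤ z → (∃ λ i → v ≤ ws i) ⊎ v ≈ z)
  cap ws =
    let D , ws<D = bounded (proj₁ ∘ ws)
        z , upper , below = cap-bounded (λ v → ∃ λ i → v ≤ ws i)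
          (λ {u} {v} u≤v (i , v≤wsᵢ) → i , ≤-trans {u} {v} u≤v v≤wsᵢ) D
          (λ (i , v≤wsᵢ) → ℕ.≤-<-trans (depth-mono v≤wsᵢ) (ws<D i))
    in z , (λ i → upper (i , ≤-refl)) , below

  ≈⇒≥ : ∀ {w v} → w ≈ v → v ≤ w
  ≈⇒≥ = inj₂ ∘ ≈-sym

  -- An infinite antichain

  -- Concluding equality of indices also makes the members pairwise distinct.
  Antichain : {I : Set} → (I → K) → Set
  Antichain w = ∀ {i j} → w i ≤ w j → i ≡ j

  Apart : ∀ {m} → K → (Fin m → K) → Set
  Apart e w = ∀ i → ¬ (e ≤ w i) × ¬ (w i ≤ e)

  next : ∀ {m} → (Fin (ℕ.suc m) → K) → Fin (ℕ.suc m) → K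
  next w i = proj₁ (cap (w ∘ punchIn i))

  ≤next : ∀ {m} (w : Fin (ℕ.suc m) → K) i j → w (punchIn i j) ≤ next w i
  ≤next w i = proj₁ (proj₂ (cap (w ∘ punchIn i)))

  next-below : ∀ {m} (w : Fin (ℕ.suc m) → K) i {v} → v ≤ next w i →
               (∃ λ j → v ≤ w (punchIn i j)) ⊎ v ≈ next w i
  next-below w i = proj₂ (proj₂ (cap (w ∘ punchIn i)))

  -- For distinct `i` and `j`, `next w i ≤ next w j` puts `w j` below the cap of the others. Then
  -- `w j` is below another member, or equals that cap and is above another member.
  next-antichain : ∀ {m} {w : Fin (ℕ.suc (ℕ.suc m)) → K} →
                   Antichain w → Antichain (next w)
  next-antichain {w = w} anti {i} {j} i≤j = decidable-stable (i ≟ j) λ i≢j →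
    let wⱼ≤next : w j ≤ next w i
        wⱼ≤next = subst (λ k → w k ≤ next w i) (punchIn-punchOut i≢j)
                        (≤next w i (punchOut i≢j))
    in Sum.[ (λ (k , wⱼ≤) → punchInᵢ≢i j k (sym (anti wⱼ≤)))
           , (λ wⱼ≈ → punchInᵢ≢i j zero
                (anti (≤-trans {v = next w j} (≤next w j zero) (≈⇒≥ wⱼ≈))))
           ] (next-below w j (≤-trans wⱼ≤next i≤j))

  next-apart : ∀ {m e} {w : Fin (ℕ.suc (ℕ.suc m)) → K} → Apart e w → Apart e (next w)
  next-apart {e = e} {w} apart i = e≰next , next≰e
    where
    next≰e : ¬ (next w i ≤ e)
    next≰e next≤e =
      proj₂ (apart (punchIn i zero)) (≤-trans {v = next w i} (≤next w i zero) next≤e)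
    e≰next : ¬ (e ≤ next w i)
    e≰next e≤next = Sum.[ (λ (j , e≤w) → proj₁ (apart (punchIn i j)) e≤w)
                        , next≰e ∘ ≈⇒≥ ] (next-below w i e≤next)

  module Iterate {m} {e : K} (w₀ : Fin (3 + m) → K)
                 (antichain₀ : Antichain w₀) (apart₀ : Apart e w₀) where

    w : ℕ → Fin (3 + m) → K
    w ℕ.zero    = w₀
    w (ℕ.suc k) = next (w k)

    antichain : ∀ k → Antichain (w k)
    antichain ℕ.zero    = antichain₀
    antichain (ℕ.suc k) = next-antichain {w = w k} (antichain k)

    apart : ∀ k → Apart e (w k)
    apart ℕ.zero    = apart₀
    apart (ℕ.suc k) = next-apart {w = w k} (apart k)

    grows : ∀ {j k} → j < k → ∀ i → ∃ λ i′ → ∀ a → w j (punchIn i′ a) ≤ w k i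
    grows {j} {ℕ.suc k} j<k i with m<1+n⇒m<n∨m≡n j<k
    ... | inj₂ refl = i , ≤next (w k) i
    -- Any index other than `i` would do for `punchIn i zero`.
    ... | inj₁ j<k′ = let i′ , wⱼ≤ = grows j<k′ (punchIn i zero) in
      i′ , λ a → ≤-trans {v = w k (punchIn i zero)} (wⱼ≤ a) (≤next (w k) i zero)

    -- By `grows`, `w k i` lies above all but one of at least three members of `w j`, hence above
    -- two distinct ones; a single `w j i′` cannot be above both.
    w≰ : ∀ {j k} → j < k → ∀ i i′ → ¬ (w k i ≤ w j i′)
    w≰ {j} {k} j<k i i′ wₖ≤wⱼ =
      let l , wⱼ≤ = grows j<k i
          eq : ∀ a → punchIn l a ≡ i′
          eq a = antichain j (≤-trans {v = w k i} (wⱼ≤ a) wₖ≤wⱼ)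
      in contradiction (punchIn-injective l 0F 1F (trans (eq 0F) (sym (eq 1F)))) λ ()

    x : ℕ → K
    x k = proj₁ (cap (e ∷ w k))

    e≤x : ∀ k → e ≤ x k
    e≤x k = proj₁ (proj₂ (cap (e ∷ w k))) zero

    w≤x : ∀ k i → w k i ≤ x k
    w≤x k i = proj₁ (proj₂ (cap (e ∷ w k))) (Fin.suc i)

    x-below : ∀ k {v} → v ≤ x k → v ≤ e ⊎ (∃ λ i → v ≤ w k i) ⊎ v ≈ x k
    x-below k v≤x with proj₂ (proj₂ (cap (e ∷ w k))) v≤x
    ... | inj₁ (zero , v≤e)      = inj₁ v≤e
    ... | inj₁ (Fin.suc i , v≤w) = inj₂ (inj₁ (i , v≤w))
    ... | inj₂ v≈x               = inj₂ (inj₂ v≈x)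

    -- Being above both `e` and members of `w j`, the point `x j` is neither below `e` nor below any
    -- `w k i`.
    x-≤⇒≈ : ∀ {j k} → x j ≤ x k → x j ≈ x k
    x-≤⇒≈ {j} {k} xⱼ≤xₖ with x-below k xⱼ≤xₖ
    ... | inj₁ xⱼ≤e              =
      contradiction (≤-trans {v = x j} (w≤x j zero) xⱼ≤e) (proj₂ (apart j zero))
    ... | inj₂ (inj₁ (i , xⱼ≤w)) =
      contradiction (≤-trans {v = x j} (e≤x j) xⱼ≤w) (proj₁ (apart k i))
    ... | inj₂ (inj₂ xⱼ≈xₖ)      = xⱼ≈xₖ

    -- Equality would put `w k zero` below `x j`. But it is not below `e`, not below the earlier
    -- `w j`, and not equal to `x j`, since it is not above `e`.
    x-≉ : ∀ {j k} → j < k → ¬ (x j ≈ x k)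
    x-≉ {j} {k} j<k xⱼ≈xₖ
      with x-below j (≤-trans {v = x k} (w≤x k zero) (≈⇒≥ xⱼ≈xₖ))
    ... | inj₁ wₖ≤e              = proj₂ (apart k zero) wₖ≤e
    ... | inj₂ (inj₁ (i , wₖ≤wⱼ)) = w≰ j<k zero i wₖ≤wⱼ
    ... | inj₂ (inj₂ wₖ≈xⱼ)      =
      proj₁ (apart k zero) (≤-trans {v = x j} (e≤x j) (≈⇒≥ wₖ≈xⱼ))

    x-antichain : Antichain x
    x-antichain {j} {k} xⱼ≤xₖ with <-cmp j k | x-≤⇒≈ {j} {k} xⱼ≤xₖ
    ... | tri< j<k _ _ | xⱼ≈xₖ = contradiction xⱼ≈xₖ (x-≉ j<k)
    ... | tri≈ _ j≡k _ | _     = j≡k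
    ... | tri> _ _ k<j | xⱼ≈xₖ = contradiction (≈-sym xⱼ≈xₖ) (x-≉ k<j)

  -- Directed sets separating the members of an antichain

  module _ (x : ℕ → K) (antichain : Antichain x) where

    avoiding : (ℕ → Bool) → DecreasingSubset poset
    avoiding S = (λ w → ∀ k → x (ℕ.suc k) ≤ w → T (S k)) ↓
                 λ {v} {w} v≤w h k x≤v → h k (≤-trans {x (ℕ.suc k)} {v} {w} x≤v v≤w)

    open DecreasingSubset

    x₀∈avoiding : ∀ S → x 0 ∈ set (avoiding S)
    x₀∈avoiding S k x≤x₀ = contradiction (antichain x≤x₀) λ ()

    avoiding-directed : ∀ S {v w} → v ∈ set (avoiding S) → w ∈ set (avoiding S) →
                        ∃ λ z → z ∈ set (avoiding S) × v ≤ z × w ≤ z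
    avoiding-directed S {v} {w} v∈ w∈ =
      let z , upper , below = cap (v ∷ w ∷ x 0 ∷ [])
          z∈ : z ∈ set (avoiding S)
          z∈ = λ k x≤z → Sum.[ (λ where
              (0F , x≤v)  → v∈ k x≤v
              (1F , x≤w)  → w∈ k x≤w
              (2F , x≤x₀) → x₀∈avoiding S k x≤x₀)
            , (λ x≈z → contradiction
                 (antichain (≤-trans {x 0} {z} (upper 2F) (≈⇒≥ x≈z))) λ ())
            ] (below x≤z)
      in z , z∈ , upper 0F , upper 1F

    x∈avoiding : ∀ {S k} → T (S k) → x (ℕ.suc k) ∈ set (avoiding S)
    x∈avoiding {S} Sk j xⱼ≤xₖ =
      subst (T ∘ S) (sym (ℕ.suc-injective (antichain xⱼ≤xₖ))) Sk

    -- The point `x (ℕ.suc k)` tests membership of `k`: it lies in `avoiding S` exactly when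
    -- `T (S k)`.
    avoiding-reflects : ∀ {S R} → (∀ {w} → w ∈ set (avoiding S) → w ∈ set (avoiding R)) →
                        ∀ k → T (S k) → T (R k)
    avoiding-reflects {S} S⊆R k Sk = S⊆R (x∈avoiding {S} Sk) k ≤-refl

    ℕ→Bool↣irreducibles :
      Injection (ℕ →-setoid Bool)
                (⊔-irreducibles (HeytingAlgebra.boundedLattice (𝓕̂ n)))
    ℕ→Bool↣irreducibles = record
      { to        = λ S → avoiding S ,
          directed⇒⊔-irreducible em poset (avoiding S) (x 0 , x₀∈avoiding S)
            (avoiding-directed S)
      ; cong      = λ S≗R → (λ h k → subst T (S≗R k) ∘ h k) ,
                            (λ h k → subst T (sym (S≗R k)) ∘ h k)
      ; injective = λ {S} {R} (S⊆R , R⊆S) k → T-injective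
          (avoiding-reflects {S} {R} S⊆R k) (avoiding-reflects {R} {S} R⊆S k)
      }

  -- Minimal points and the starting antichain

  minimal : Subset n → K
  minimal β = 0 , record
    { β            = β
    ; Y            = λ ()
    ; decreasing   = λ {x} → ⊥-elim x
    ; fresh        = tt
    ; β⊆val        = λ ()
    ; notPrincipal = λ ()
    }

  minimal-≤⇒≡ : ∀ {β γ} → minimal β ≤ minimal γ → β ≡ γ
  minimal-≤⇒≡ (inj₂ (same (β≡γ , _))) = β≡γ

-- The first two symbols, available because `n > 1`, give four valuations: one for `e` and three for
-- the starting triple.
fourSubsets : ∀ {m} → Fin 4 → Subset (2 + m)
fourSubsets 0F = outside ∷ᵛ outside ∷ᵛ ∅ˢ
fourSubsets 1F = outside ∷ᵛ inside  ∷ᵛ ∅ˢ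
fourSubsets 2F = inside  ∷ᵛ outside ∷ᵛ ∅ˢ
fourSubsets 3F = inside  ∷ᵛ inside  ∷ᵛ ∅ˢ

fourSubsets-injective : ∀ {m i j} → fourSubsets {m} i ≡ fourSubsets j → i ≡ j
fourSubsets-injective {m} {i} {j} eq =
  trans (sym (decode-four i)) (trans (cong decode eq) (decode-four j))
  where
  decode : Subset (2 + m) → Fin 4
  decode (false ∷ᵛ false ∷ᵛ _) = 0F
  decode (false ∷ᵛ true  ∷ᵛ _) = 1F
  decode (true  ∷ᵛ false ∷ᵛ _) = 2F
  decode (true  ∷ᵛ true  ∷ᵛ _) = 3F
  decode-four : ∀ i → decode (fourSubsets i) ≡ i
  decode-four 0F = refl
  decode-four 1F = refl
  decode-four 2F = refl
  decode-four 3F = refl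

proposition7p3 : ExcludedMiddle (suc 0ℓ) → (n : ℕ) → n > 1 →
    Bijection (⊔-irreducibles (HeytingAlgebra.boundedLattice (𝓕̂ n))) (ℕ →-setoid Bool)
proposition7p3 em n@(ℕ.suc (ℕ.suc _)) (s≤s (s≤s _)) = cantor-schröder-bernstein em
  (irreducibles↣ℕ→Bool em₀ poset (code em₀ n) (code-injective em₀ n))
  (ℕ→Bool↣irreducibles em₀ n x x-antichain)
  where
  open Construction n using (K; poset; _≤_)
  -- Cantor-Schröder-Bernstein takes `em` one level up, where decreasing subsets live; statements
  -- about points of `K` are small.
  em₀ : ExcludedMiddle 0ℓ
  em₀ = lower-em 0ℓ (suc 0ℓ) em
  p : Fin 4 → K
  p = minimal em₀ n ∘ fourSubsets
  p-antichain : Antichain em₀ n p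
  p-antichain = fourSubsets-injective ∘ minimal-≤⇒≡ em₀ n
  apart : Apart em₀ n (p 0F) (p ∘ Fin.suc)
  apart i = (λ e≤p → contradiction (p-antichain {0F} {Fin.suc i} e≤p) λ ()) ,
            (λ p≤e → contradiction (p-antichain {Fin.suc i} {0F} p≤e) λ ())
  open Iterate em₀ n (p ∘ Fin.suc) (suc-injective ∘ p-antichain) apart
    using (x; x-antichain)
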